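{- Let $n\ge 1$ and $k\ge 2$ be integers and let $R\in(0,k]$. Suppose $\mathcal A$ is a (possibly randomized and adaptive) algorithm that makes $s$ queries, each a vector $\mathbf x\in\{ -k,\dots,k\}^n$ answered by $\|\mathbf x-\mathbf y\|_\infty$, and that for every $\mathbf y\in\{ -k,\dots,k\}^n$ outputs $\mathbf y'\in\{ -k,\dots,k\}^n$ with $\|\mathbf y'-\mathbf y\|_\infty\le R$ with probability at least $2/3$ over its random coins. Then $s=\Omega\!\left(\frac{n\log(k/R)}{\log k}\right)$. In particular, if $R\le k^{1-\varepsilon}$ for a constant $\varepsilon>0$, then $s=\Omega(n)$.
   Context: $\|\mathbf z\|_\infty=\max_i|z_i|$. "Adaptive" means each query may depend on answers to previous queries. Constants in $\Omega(\cdot)$ may depend on $\varepsilon$.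
   Formalization: In the first bound the Ω-constant may depend on a fixed r > 0 with R ≥ r (absolute for R ≥ 1): for n=1, k=2 one query x=k determines y, so s=1 suffices for every R, while log(k/R) is unbounded as R→0. Randomness is a finite distribution over decision trees. -}

module Defs where

open import Data.Bool using (Bool; true; if_then_else_)
open import Data.Fin using (Fin)
open import Data.Integer as ℤ using (ℤ; +_; ∣_∣)
open import Data.Nat as ℕ using (ℕ; suc)
open import Data.Product using (Σ-syntax; ∃-syntax; _×_; _,_; proj₁)
open import Data.Rational as ℚ using (ℚ; 0ℚ; 1ℚ; ½)
import Data.Rational.Properties as ℚₚ
open import Data.Rational.Solver using (module +-*-Solver)
open import Data.Vec using (Vec; foldr′; map; zipWith)
import Data.Vec.Functional as Vector
open import Relation.Binary.PropositionalEquality using (_≡_; refl; cong; subst; sym; trans)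

-- Two-sided Dedekind cuts of ℚ. `Lower q` means q < x and `Upper q` means x < q.
-- The field `located` also makes both cuts inhabited.

record ℝ : Set₁ where
  field
    Lower Upper  : ℚ → Set
    lower-closed : ∀ {p q} → p ℚ.< q → Lower q → Lower p
    lower-open   : ∀ {p} → Lower p → ∃[ q ] p ℚ.< q × Lower q
    upper-closed : ∀ {p q} → p ℚ.< q → Upper p → Upper q
    upper-open   : ∀ {q} → Upper q → ∃[ p ] p ℚ.< q × Upper p
    disjoint     : ∀ {p q} → Lower p → Upper q → p ℚ.< q
    located      : ∀ δ → 0ℚ ℚ.< δ → ∃[ p ] ∃[ q ] Lower p × Upper q × q ℚ.≤ p ℚ.+ δ

open ℝ public

infix 4 _≤ʳ_ _<ʳ_ _≃ʳ_

_≤ʳ_ : ℝ → ℝ → Set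
x ≤ʳ y = ∀ q → Lower x q → Lower y q

_<ʳ_ : ℝ → ℝ → Set
x <ʳ y = ∃[ q ] Upper x q × Lower y q

_≃ʳ_ : ℝ → ℝ → Set
x ≃ʳ y = x ≤ʳ y × y ≤ʳ x

½-pos : ∀ {δ} → 0ℚ ℚ.< δ → 0ℚ ℚ.< ½ ℚ.* δ
½-pos {δ} 0<δ = subst (ℚ._< ½ ℚ.* δ) (ℚₚ.*-zeroʳ ½) (ℚₚ.*-monoʳ-<-pos ½ 0<δ)

halves : ∀ δ → ½ ℚ.* δ ℚ.+ ½ ℚ.* δ ≡ δ
halves δ = trans (sym (ℚₚ.*-distribʳ-+ δ ½ ½)) (ℚₚ.*-identityˡ δ)

fromℚ : ℚ → ℝ
fromℚ x = record
  { Lower        = ℚ._< x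
  ; Upper        = x ℚ.<_
  ; lower-closed = ℚₚ.<-trans
  ; lower-open   = ℚₚ.<-dense
  ; upper-closed = λ p<q x<p → ℚₚ.<-trans x<p p<q
  ; upper-open   = λ x<q → let m , x<m , m<q = ℚₚ.<-dense x<q in m , m<q , x<m
  ; disjoint     = ℚₚ.<-trans
  ; located      = λ δ 0<δ →
      let h   = ½ ℚ.* δ
          0<h = ½-pos 0<δ
      in  x ℚ.- h , x ℚ.+ h
        , subst (x ℚ.- h ℚ.<_) (ℚₚ.+-identityʳ x) (ℚₚ.+-monoʳ-< x (ℚₚ.neg-antimono-< 0<h))
        , subst (ℚ._< x ℚ.+ h) (ℚₚ.+-identityʳ x) (ℚₚ.+-monoʳ-< x 0<h)
        , ℚₚ.≤-reflexive (trans (shift x h) (cong (λ d → x ℚ.- h ℚ.+ d) (halves δ)))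
  }
  where
  open +-*-Solver
  shift : ∀ x h → x ℚ.+ h ≡ x ℚ.- h ℚ.+ (h ℚ.+ h)
  shift = solve 2 (λ x h → x :+ h := x :- h :+ (h :+ h)) refl

fromℕ : ℕ → ℝ
fromℕ m = fromℚ (+ m ℚ./ 1)

0ʳ 1ʳ : ℝ
0ʳ = fromℚ 0ℚ
1ʳ = fromℚ 1ℚ

infixl 6 _+ʳ_

_+ʳ_ : ℝ → ℝ → ℝ
x +ʳ y = record
  { Lower        = λ q → ∃[ a ] ∃[ b ] Lower x a × Lower y b × q ℚ.< a ℚ.+ b
  ; Upper        = λ q → ∃[ a ] ∃[ b ] Upper x a × Upper y b × a ℚ.+ b ℚ.< q
  ; lower-closed = λ p<q (a , b , la , lb , q<s) → a , b , la , lb , ℚₚ.<-trans p<q q<s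
  ; lower-open   = λ (a , b , la , lb , p<s) →
      let m , p<m , m<s = ℚₚ.<-dense p<s in m , p<m , a , b , la , lb , m<s
  ; upper-closed = λ p<q (a , b , ua , ub , s<p) → a , b , ua , ub , ℚₚ.<-trans s<p p<q
  ; upper-open   = λ (a , b , ua , ub , s<q) →
      let m , s<m , m<q = ℚₚ.<-dense s<q in m , m<q , a , b , ua , ub , s<m
  ; disjoint     = λ (a , b , la , lb , p<s) (c , d , uc , ud , t<q) →
      ℚₚ.<-trans p<s (ℚₚ.<-trans (ℚₚ.+-mono-< (disjoint x la uc) (disjoint y lb ud)) t<q)
  ; located      = λ δ 0<δ →
      let h = ½ ℚ.* δ
          p  , q  , lp  , uq  , q≤  = located x h (½-pos 0<δ)
          p′ , q′ , lp′ , uq′ , q′≤ = located y h (½-pos 0<δ)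
          a  , p<a   , la = lower-open x lp
          a′ , p′<a′ , la′ = lower-open y lp′
          b  , b<q   , ub = upper-open x uq
          b′ , b′<q′ , ub′ = upper-open y uq′
      in  p ℚ.+ p′ , q ℚ.+ q′
        , (a , a′ , la , la′ , ℚₚ.+-mono-< p<a p′<a′)
        , (b , b′ , ub , ub′ , ℚₚ.+-mono-< b<q b′<q′)
        , ℚₚ.≤-trans (ℚₚ.+-mono-≤ q≤ q′≤)
            (ℚₚ.≤-reflexive (trans (shuffle p p′ h) (cong (λ d → p ℚ.+ p′ ℚ.+ d) (halves δ))))
  }
  where
  open +-*-Solver
  shuffle : ∀ p p′ h → (p ℚ.+ h) ℚ.+ (p′ ℚ.+ h) ≡ p ℚ.+ p′ ℚ.+ (h ℚ.+ h)
  shuffle = solve 3 (λ p p′ h → (p :+ h) :+ (p′ :+ h) := p :+ p′ :+ (h :+ h)) refl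

sumʳ : ∀ {m} → (Fin m → ℝ) → ℝ
sumʳ = Vector.foldr _+ʳ_ 0ʳ

open import Algebra.Definitions.RawSemiring ℚ.+-*-rawSemiring public
  using () renaming (_^_ to _^ℚ_)

-- m · log (j / x) ≤ t · log k, for x > 0 and k ≥ 2. Exponentiating and clearing the
-- denominator gives jᵐ ≤ kᵗ xᵐ, and by continuity and monotonicity of xᵐ this
-- holds iff it holds with x replaced by every rational q > x.

infix 4 _·log[_÷_]≤_·log_

_·log[_÷_]≤_·log_ : ℕ → ℕ → ℝ → ℕ → ℕ → Set
m ·log[ j ÷ x ]≤ t ·log k =
  ∀ q → Upper x q → (+ j ℚ./ 1) ^ℚ m ℚ.≤ (+ k ℚ./ 1) ^ℚ t ℚ.* q ^ℚ m

-- x ≤ k¹⁻ᵉ, for x, e > 0 and k ≥ 2. Since k¹⁻ᵉ is the infimum of k¹⁻ᵃᐟᵇ over the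
-- rationals a/b < e, this says pᵇ kᵃ ≤ kᵇ for all such a/b and all rationals 0 ≤ p < x.

infix 4 _≤ʳ_^1-_

_≤ʳ_^1-_ : ℝ → ℕ → ℝ → Set
x ≤ʳ k ^1- e = ∀ a b .{{_ : ℕ.NonZero b}} → Lower e (+ a ℚ./ b) →
  ∀ p → 0ℚ ℚ.≤ p → Lower x p →
  p ^ℚ b ℚ.* (+ k ℚ./ 1) ^ℚ a ℚ.≤ (+ k ℚ./ 1) ^ℚ b

Interval : ℕ → Set
Interval k = Σ[ z ∈ ℤ ] (ℤ.- (+ k) ℤ.≤ z × z ℤ.≤ + k)

Cube : ℕ → ℕ → Set
Cube k n = Vec (Interval k) n

‖_‖∞ : ∀ {n} → Vec ℤ n → ℕ
‖ z ‖∞ = foldr′ ℕ._⊔_ 0 (map ∣_∣ z)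

dist∞ : ∀ {k n} → Cube k n → Cube k n → ℕ
dist∞ x y = ‖ zipWith ℤ._-_ (map proj₁ x) (map proj₁ y) ‖∞

-- Deterministic adaptive algorithms making at most s queries on every input.

data DecisionTree (k n : ℕ) : ℕ → Set where
  output : ∀ {s} → Cube k n → DecisionTree k n s
  query  : ∀ {s} → Cube k n → (ℕ → DecisionTree k n s) → DecisionTree k n (suc s)

run : ∀ {k n s} → DecisionTree k n s → Cube k n → Cube k n
run (output z)  y = z
run (query x f) y = run (f (dist∞ x y)) y

-- All coins are drawn in advance. Finitely many outcomes with arbitrary real
-- probabilities lose no generality: for given k, n, s only finitely many decision
-- trees differ on the answers that can occur (those at most 2k).

record RandomizedAlgorithm (k n s : ℕ) : Set₁ where
  field
    outcomes    : ℕ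
    prob        : Fin outcomes → ℝ
    prob-nonneg : ∀ ω → 0ʳ ≤ʳ prob ω
    prob-total  : sumʳ prob ≃ʳ 1ʳ
    tree        : Fin outcomes → DecisionTree k n s

  -- An event E need not be decidable (it may compare with a real number), so its
  -- probability is bounded below through a decidable event D contained in it.
  ProbAtLeast : ℝ → (Fin outcomes → Set) → Set
  ProbAtLeast t E = Σ[ D ∈ (Fin outcomes → Bool) ]
    (∀ ω → D ω ≡ true → E ω) ×
    t ≤ʳ sumʳ (λ ω → if D ω then prob ω else 0ʳ)

  Approximates : ℝ → Set
  Approximates R = ∀ (y : Cube k n) →
    ProbAtLeast (fromℚ (+ 2 ℚ./ 3)) (λ ω → fromℕ (dist∞ (run (tree ω) y) y) ≤ʳ R)

open RandomizedAlgorithm public using (Approximates)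

-- Fix ρ < k and place M = ⌊2k / (2ρ + 1)⌋ + 1 ≥ 2 points at spacing 2ρ + 1 along each axis.
-- An output is within ρ of at most one of the resulting Mⁿ grid points, and a decision tree
-- of depth s with answers in {0, …, 2k} has at most (2k + 1)ˢ leaves, so it is correct on at
-- most (2k + 1)ˢ grid points. Averaging over the coins gives ⅔ Mⁿ ≤ (2k + 1)ˢ, hence
-- Mⁿ ≤ k⁴ˢ. Taking ρ = ⌊q⌋ for a rational q > R, the first bound follows from k ≤ M¹⁺ᶜ q where
-- 1 ≤ c q. For the second, R ≤ k¹⁻ᵃᐟᵇ lets q be chosen so close to R that k ≤ M³ᵇ.

module Submission where

open import Defs
open import Data.Nat using (ℕ; _≤_; _*_)
open import Data.Product using (_×_; ∃-syntax)

open import Algebra using (CommutativeRing)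
open import Data.Bool using (Bool; T; true; false; if_then_else_; _∧_)
import Data.Bool.Properties as Boolₚ
open import Data.Fin as Fin using (Fin; zero; suc; toℕ; fromℕ<; finToFun; funToFin; combine)
import Data.Fin.Properties as Finₚ
open import Data.Integer as ℤ using (ℤ; +_; -[1+_]; ∣_∣)
import Data.Integer.Properties as ℤₚ
import Data.Integer.Solver as ℤ-Solver
open import Data.Nat as ℕ using (zero; suc; _+_; _<_; _^_; z≤n; s≤s; NonZero)
import Data.Nat.DivMod as ℕ
import Data.Nat.Properties as ℕₚ
import Data.Nat.Solver as ℕ-Solver
open import Data.Product using (_,_; proj₁; proj₂)
open import Data.Rational as ℚ using (ℚ; mkℚ; 0ℚ; 1ℚ; Positive)
import Data.Rational.Properties as ℚₚ
import Data.Rational.Solver as ℚ-Solver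
import Data.Rational.Unnormalised as ℚᵘ
import Data.Rational.Unnormalised.Properties as ℚᵘₚ
open import Data.Vec using (Vec; []; _∷_; map; tabulate; lookup)
import Data.Vec.Functional as Vector
import Data.Vec.Properties as Vecₚ
open import Function using (_∘_; _$_)
open import Relation.Binary.PropositionalEquality
  using (_≡_; _≗_; refl; sym; trans; cong; cong₂; subst; subst₂; module ≡-Reasoning)
open import Relation.Nullary using (¬_; Dec; yes; no; contradiction)
open import Relation.Nullary.Decidable using (from-yes; from-no)

private
  module R = CommutativeRing ℚₚ.+-*-commutativeRing

open import Algebra.Properties.CommutativeSemiring.Exp R.commutativeSemiring
  using (^-distrib-*)
open import Algebra.Properties.Semiring.Sum R.semiring
  using (sum; sum-syntax; ∑-comm; *-distribˡ-sum)

-- The embedding of the natural numbers in the rationals.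

-- Opaque because otherwise the gcd in _/_ is unfolded on open terms.
opaque
  ι : ℕ → ℚ
  ι m = + m ℚ./ 1

  ι-def : ∀ m → ι m ≡ + m ℚ./ 1
  ι-def m = refl

  toℚᵘ-ι : ∀ m → ℚ.toℚᵘ (ι m) ℚᵘ.≃ ℚᵘ.mkℚᵘ (+ m) 0
  toℚᵘ-ι m = ℚₚ.toℚᵘ-fromℚᵘ (ℚᵘ.mkℚᵘ (+ m) 0)

ι-mono-≤ : ∀ {m n} → m ≤ n → ι m ℚ.≤ ι n
ι-mono-≤ {m} {n} m≤n = ℚₚ.toℚᵘ-cancel-≤ (begin
  ℚ.toℚᵘ (ι m)       ≃⟨ toℚᵘ-ι m ⟩
  ℚᵘ.mkℚᵘ (+ m) 0    ≤⟨ ℚᵘ.*≤* (ℤₚ.*-monoʳ-≤-nonNeg (+ 1) (ℤ.+≤+ m≤n)) ⟩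
  ℚᵘ.mkℚᵘ (+ n) 0    ≃⟨ toℚᵘ-ι n ⟨
  ℚ.toℚᵘ (ι n)       ∎)
  where open ℚᵘₚ.≤-Reasoning

ι-mono-< : ∀ {m n} → m < n → ι m ℚ.< ι n
ι-mono-< {m} {n} m<n = ℚₚ.toℚᵘ-cancel-< (begin-strict
  ℚ.toℚᵘ (ι m)       ≃⟨ toℚᵘ-ι m ⟩
  ℚᵘ.mkℚᵘ (+ m) 0    <⟨ ℚᵘ.*<* (ℤₚ.*-monoʳ-<-pos (+ 1) (ℤ.+<+ m<n)) ⟩
  ℚᵘ.mkℚᵘ (+ n) 0    ≃⟨ toℚᵘ-ι n ⟨
  ℚ.toℚᵘ (ι n)       ∎)
  where open ℚᵘₚ.≤-Reasoning

ι-cancel-≤ : ∀ {m n} → ι m ℚ.≤ ι n → m ≤ n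
ι-cancel-≤ {m} {n} ιm≤ιn =
  ℕₚ.≮⇒≥ λ n<m → ℚₚ.<-irrefl refl (ℚₚ.<-≤-trans (ι-mono-< n<m) ιm≤ιn)

ι-cancel-< : ∀ {m n} → ι m ℚ.< ι n → m < n
ι-cancel-< {m} {n} ιm<ιn =
  ℕₚ.≰⇒> λ n≤m → ℚₚ.<-irrefl refl (ℚₚ.<-≤-trans ιm<ιn (ι-mono-≤ n≤m))

ι-+ : ∀ m n → ι (m + n) ≡ ι m ℚ.+ ι n
ι-+ m n = ℚₚ.toℚᵘ-injective (begin
  ℚ.toℚᵘ (ι (m + n))                        ≈⟨ toℚᵘ-ι (m + n) ⟩
  ℚᵘ.mkℚᵘ (+ (m + n)) 0                     ≈⟨ ℚᵘ.*≡* (cong (ℤ._* + 1) (sym (cong₂ ℤ._+_ (ℤₚ.*-identityʳ (+ m)) (ℤₚ.*-identityʳ (+ n))))) ⟩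
  ℚᵘ.mkℚᵘ (+ m) 0 ℚᵘ.+ ℚᵘ.mkℚᵘ (+ n) 0      ≈⟨ ℚᵘₚ.+-cong (toℚᵘ-ι m) (toℚᵘ-ι n) ⟨
  ℚ.toℚᵘ (ι m) ℚᵘ.+ ℚ.toℚᵘ (ι n)            ≈⟨ ℚₚ.toℚᵘ-homo-+ (ι m) (ι n) ⟨
  ℚ.toℚᵘ (ι m ℚ.+ ι n)                      ∎)
  where open ℚᵘₚ.≃-Reasoning

ι-* : ∀ m n → ι (m * n) ≡ ι m ℚ.* ι n
ι-* m n = ℚₚ.toℚᵘ-injective (begin
  ℚ.toℚᵘ (ι (m * n))                        ≈⟨ toℚᵘ-ι (m * n) ⟩
  ℚᵘ.mkℚᵘ (+ (m * n)) 0                     ≈⟨ ℚᵘ.*≡* (cong (ℤ._* + 1) (ℤₚ.pos-* m n)) ⟩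
  ℚᵘ.mkℚᵘ (+ m) 0 ℚᵘ.* ℚᵘ.mkℚᵘ (+ n) 0      ≈⟨ ℚᵘₚ.*-cong (toℚᵘ-ι m) (toℚᵘ-ι n) ⟨
  ℚ.toℚᵘ (ι m) ℚᵘ.* ℚ.toℚᵘ (ι n)            ≈⟨ ℚₚ.toℚᵘ-homo-* (ι m) (ι n) ⟨
  ℚ.toℚᵘ (ι m ℚ.* ι n)                      ∎)
  where open ℚᵘₚ.≃-Reasoning

ι-^ : ∀ m n → ι (m ^ n) ≡ ι m ^ℚ n
ι-^ m zero    = ι-def 1
ι-^ m (suc n) = trans (ι-* m (m ^ n)) (cong (ι m ℚ.*_) (ι-^ m n))

0≤ι : ∀ m → 0ℚ ℚ.≤ ι m
0≤ι m = subst (ℚ._≤ ι m) (ι-def 0) (ι-mono-≤ {0} {m} z≤n)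

1≤ι : ∀ {m} → 1 ≤ m → 1ℚ ℚ.≤ ι m
1≤ι {m} 1≤m = subst (ℚ._≤ ι m) (ι-def 1) (ι-mono-≤ 1≤m)

0<ι : ∀ {m} → 0 < m → 0ℚ ℚ.< ι m
0<ι {m} 0<m = subst (ℚ._< ι m) (ι-def 0) (ι-mono-< 0<m)

-- Products, powers and integer parts of nonnegative rationals.

*-mono-≤-nonNeg : ∀ {p q r s} → 0ℚ ℚ.≤ p → 0ℚ ℚ.≤ s → p ℚ.≤ q → r ℚ.≤ s → p ℚ.* r ℚ.≤ q ℚ.* s
*-mono-≤-nonNeg {p} {s = s} 0≤p 0≤s p≤q r≤s = ℚₚ.≤-trans
  (ℚₚ.*-monoˡ-≤-nonNeg p {{ℚ.nonNegative 0≤p}} r≤s)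
  (ℚₚ.*-monoʳ-≤-nonNeg s {{ℚ.nonNegative 0≤s}} p≤q)

*-nonNeg : ∀ {p q} → 0ℚ ℚ.≤ p → 0ℚ ℚ.≤ q → 0ℚ ℚ.≤ p ℚ.* q
*-nonNeg {p} {q} 0≤p 0≤q =
  subst (ℚ._≤ p ℚ.* q) (ℚₚ.*-zeroˡ q) (*-mono-≤-nonNeg ℚₚ.≤-refl 0≤q 0≤p ℚₚ.≤-refl)

^ℚ-nonNeg : ∀ {p} n → 0ℚ ℚ.≤ p → 0ℚ ℚ.≤ p ^ℚ n
^ℚ-nonNeg zero    0≤p = ℚₚ.nonNegative⁻¹ 1ℚ
^ℚ-nonNeg (suc n) 0≤p = *-nonNeg 0≤p (^ℚ-nonNeg n 0≤p)

^ℚ-mono-≤ : ∀ {p q} n → 0ℚ ℚ.≤ p → p ℚ.≤ q → p ^ℚ n ℚ.≤ q ^ℚ n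
^ℚ-mono-≤ zero    0≤p p≤q = ℚₚ.≤-refl
^ℚ-mono-≤ (suc n) 0≤p p≤q =
  *-mono-≤-nonNeg 0≤p (^ℚ-nonNeg n (ℚₚ.≤-trans 0≤p p≤q)) p≤q (^ℚ-mono-≤ n 0≤p p≤q)

-- A descending search from `N`. Taken with `N = k`, it yields `ρ < k`, which is what makes room for
-- two sites per axis.
floor : ∀ N q → 0ℚ ℚ.≤ q → q ℚ.< ι N → ∃[ ρ ] ρ < N × ι ρ ℚ.≤ q × q ℚ.< ι (suc ρ)
floor zero    q 0≤q q<0 =
  contradiction (ℚₚ.≤-<-trans 0≤q (subst (q ℚ.<_) (ι-def 0) q<0)) (ℚₚ.<-irrefl refl)
floor (suc N) q 0≤q q<N+1 with ℚₚ._≤?_ (ι N) q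
... | yes N≤q = N , ℕₚ.≤-refl , N≤q , q<N+1
... | no  N≰q with ρ , ρ<N , ρ≤q , q<ρ+1 ← floor N q 0≤q (ℚₚ.≰⇒> N≰q) =
  ρ , ℕₚ.m<n⇒m<1+n ρ<N , ρ≤q , q<ρ+1

-- Finite sums and indicator weights.

sum-mono-≤ : ∀ {m} {f g : Fin m → ℚ} → (∀ i → f i ℚ.≤ g i) → sum f ℚ.≤ sum g
sum-mono-≤ {zero}  f≤g = ℚₚ.≤-refl
sum-mono-≤ {suc m} f≤g = ℚₚ.+-mono-≤ (f≤g zero) (sum-mono-≤ (f≤g ∘ suc))

sum-const : ∀ m q → ∑[ i < m ] q ≡ ι m ℚ.* q
sum-const zero    q = sym (trans (cong (ℚ._* q) (ι-def 0)) (ℚₚ.*-zeroˡ q))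
sum-const (suc m) q = begin
  q ℚ.+ (∑[ i < m ] q)     ≡⟨ cong₂ ℚ._+_ (sym (ℚₚ.*-identityˡ q)) (sum-const m q) ⟩
  1ℚ ℚ.* q ℚ.+ ι m ℚ.* q   ≡⟨ ℚₚ.*-distribʳ-+ q 1ℚ (ι m) ⟨
  (1ℚ ℚ.+ ι m) ℚ.* q       ≡⟨ cong (λ x → (x ℚ.+ ι m) ℚ.* q) (ι-def 1) ⟨
  (ι 1 ℚ.+ ι m) ℚ.* q      ≡⟨ cong (ℚ._* q) (ι-+ 1 m) ⟨
  ι (suc m) ℚ.* q          ∎
  where open ≡-Reasoning

sum-nonNeg : ∀ {m} {f : Fin m → ℚ} → (∀ i → 0ℚ ℚ.≤ f i) → 0ℚ ℚ.≤ sum f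
sum-nonNeg {zero}  0≤f = ℚₚ.≤-refl
sum-nonNeg {suc m} 0≤f = ℚₚ.+-mono-≤ (0≤f zero) (sum-nonNeg (0≤f ∘ suc))

term≤sum : ∀ {m} {f : Fin m → ℚ} → (∀ i → 0ℚ ℚ.≤ f i) → ∀ i → f i ℚ.≤ sum f
term≤sum {suc m} {f} 0≤f zero =
  subst (ℚ._≤ sum f) (ℚₚ.+-identityʳ (f zero)) (ℚₚ.+-monoʳ-≤ (f zero) (sum-nonNeg (0≤f ∘ suc)))
term≤sum {suc m} {f} 0≤f (suc i) =
  subst (ℚ._≤ sum f) (ℚₚ.+-identityˡ (f (suc i))) (ℚₚ.+-mono-≤ (0≤f zero) (term≤sum (0≤f ∘ suc) i))

infix 11 _⟦_⟧

_⟦_⟧ : ℚ → Bool → ℚ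
u ⟦ b ⟧ = if b then u else 0ℚ

⟦⟧-nonNeg : ∀ {u} b → 0ℚ ℚ.≤ u → 0ℚ ℚ.≤ u ⟦ b ⟧
⟦⟧-nonNeg true  0≤u = 0≤u
⟦⟧-nonNeg false 0≤u = ℚₚ.≤-refl

-- Meant for a leaf of a decision tree, whose single output can be right for at most one grid point.
sum-unique-≤ : ∀ {m u} (D : Fin m → Bool) → 0ℚ ℚ.≤ u →
  (∀ i j → D i ≡ true → D j ≡ true → i ≡ j) → ∑[ i < m ] u ⟦ D i ⟧ ℚ.≤ u
sum-unique-≤ {zero}      D 0≤u unique = 0≤u
sum-unique-≤ {suc m} {u} D 0≤u unique with D zero in D₀
... | true  = ℚₚ.≤-trans
  (ℚₚ.+-monoʳ-≤ u (sum-mono-≤ {g = λ _ → 0ℚ} others))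
  (ℚₚ.≤-reflexive (trans (cong (u ℚ.+_) (trans (sum-const m 0ℚ) (ℚₚ.*-zeroʳ (ι m)))) (ℚₚ.+-identityʳ u)))
  where
  others : ∀ i → u ⟦ D (suc i) ⟧ ℚ.≤ 0ℚ
  others i with D (suc i) in Dᵢ
  ... | false = ℚₚ.≤-refl
  ... | true  with () ← unique zero (suc i) D₀ Dᵢ
... | false = subst (ℚ._≤ u) (sym (ℚₚ.+-identityˡ _))
  (sum-unique-≤ (D ∘ suc) 0≤u λ i j Dᵢ Dⱼ → Finₚ.suc-injective (unique (suc i) (suc j) Dᵢ Dⱼ))

-- Splits a weight according to the answer to a query: the summand at `a = d` already carries all of
-- it, and `d ≤ N` makes this `a` a valid index.
⟦⟧≤sum : ∀ {u} N {d} b → 0ℚ ℚ.≤ u → d ≤ N →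
  u ⟦ b ⟧ ℚ.≤ ∑[ a < suc N ] u ⟦ b ∧ (toℕ a ℕ.≡ᵇ d) ⟧
⟦⟧≤sum {u} N {d} b 0≤u d≤N = subst (λ c → u ⟦ c ⟧ ℚ.≤ ∑[ a < suc N ] u ⟦ b ∧ (toℕ a ℕ.≡ᵇ d) ⟧)
  b∧≡b (term≤sum (λ a → ⟦⟧-nonNeg (b ∧ (toℕ a ℕ.≡ᵇ d)) 0≤u) a₀)
  where
  a₀ = fromℕ< (s≤s d≤N)
  ≡ᵇ-refl : ∀ m → (m ℕ.≡ᵇ m) ≡ true
  ≡ᵇ-refl zero    = refl
  ≡ᵇ-refl (suc m) = ≡ᵇ-refl m
  b∧≡b : b ∧ (toℕ a₀ ℕ.≡ᵇ d) ≡ b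
  b∧≡b = trans (cong (λ x → b ∧ (x ℕ.≡ᵇ d)) (Finₚ.toℕ-fromℕ< (s≤s d≤N)))
    (trans (cong (b ∧_) (≡ᵇ-refl d)) (Boolₚ.∧-identityʳ b))

-- Counting the inputs on which a decision tree is right.

dist∞≤2k : ∀ {k n} (x y : Cube k n) → dist∞ x y ≤ 2 * k
dist∞≤2k []      []      = z≤n
dist∞≤2k {k} ((x , lx , ux) ∷ xs) ((y , ly , uy) ∷ ys) =
  ℕₚ.⊔-lub (ℕₚ.≤-trans (ℤₚ.∣i-j∣≤∣i∣+∣j∣ x y) bound) (dist∞≤2k xs ys)
  where
  ∣_∣≤k : ∀ z → ℤ.- (+ k) ℤ.≤ z → z ℤ.≤ + k → ∣ z ∣ ≤ k
  ∣ + m ∣≤k      l (ℤ.+≤+ m≤k) = m≤k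
  ∣ -[1+ m ] ∣≤k l u = ℤₚ.drop‿+≤+
    (subst (+ suc m ℤ.≤_) (ℤₚ.neg-involutive (+ k)) (ℤₚ.neg-mono-≤ l))
  bound : ∣ x ∣ + ∣ y ∣ ≤ 2 * k
  bound = ℕₚ.+-mono-≤ (∣ x ∣≤k lx ux)
    (ℕₚ.≤-trans (∣ y ∣≤k ly uy) (ℕₚ.≤-reflexive (sym (ℕₚ.+-identityʳ k))))

-- Induction on the tree. A query splits the marked points into `2k + 1` classes by their answer,
-- and the subtree for an answer is right on its class. At a leaf, separation leaves at most one
-- marked point. The factor `u` is the weight of one coin outcome, so that the bounds can later be
-- added up.
weight-bound : ∀ {k n s m u ρ} (t : DecisionTree k n s) (g : Fin m → Cube k n) (D : Fin m → Bool) →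
  0ℚ ℚ.≤ u →
  (∀ z i j → dist∞ z (g i) ≤ ρ → dist∞ z (g j) ≤ ρ → i ≡ j) →
  (∀ i → D i ≡ true → dist∞ (run t (g i)) (g i) ≤ ρ) →
  ∑[ i < m ] u ⟦ D i ⟧ ℚ.≤ ι (suc (2 * k) ^ s) ℚ.* u
weight-bound {k} {s = s} {m} {u} (output z) g D 0≤u separated correct = begin
  ∑[ i < m ] u ⟦ D i ⟧          ≤⟨ sum-unique-≤ D 0≤u (λ i j Dᵢ Dⱼ → separated z i j (correct i Dᵢ) (correct j Dⱼ)) ⟩
  -- A leaf may occur with query budget `s` left over, so 1 is enlarged to `(2k + 1)^s`.
  u                             ≡⟨ ℚₚ.*-identityˡ u ⟨
  1ℚ ℚ.* u                      ≤⟨ ℚₚ.*-monoʳ-≤-nonNeg u {{ℚ.nonNegative 0≤u}} (1≤ι (ℕₚ.m^n>0 (suc (2 * k)) s)) ⟩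
  ι (suc (2 * k) ^ s) ℚ.* u     ∎
  where open ℚₚ.≤-Reasoning
weight-bound {k} {n} {suc s} {m} {u} {ρ} (query x f) g D 0≤u separated correct = begin
  ∑[ i < m ] u ⟦ D i ⟧                            ≤⟨ sum-mono-≤ (λ i → ⟦⟧≤sum (2 * k) (D i) 0≤u (dist∞≤2k x (g i))) ⟩
  ∑[ i < m ] ∑[ a < suc (2 * k) ] u ⟦ Dₐ a i ⟧    ≡⟨ ∑-comm (λ i a → u ⟦ Dₐ a i ⟧) ⟩
  ∑[ a < suc (2 * k) ] ∑[ i < m ] u ⟦ Dₐ a i ⟧    ≤⟨ sum-mono-≤ (λ a → weight-bound (f (toℕ a)) g (Dₐ a) 0≤u separated (correctₐ a)) ⟩
  ∑[ a < suc (2 * k) ] (ι L ℚ.* u)                ≡⟨ sum-const (suc (2 * k)) (ι L ℚ.* u) ⟩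
  ι (suc (2 * k)) ℚ.* (ι L ℚ.* u)                 ≡⟨ ℚₚ.*-assoc (ι (suc (2 * k))) (ι L) u ⟨
  ι (suc (2 * k)) ℚ.* ι L ℚ.* u                   ≡⟨ cong (ℚ._* u) (ι-* (suc (2 * k)) L) ⟨
  ι (suc (2 * k) ^ suc s) ℚ.* u                   ∎
  where
  open ℚₚ.≤-Reasoning
  L = suc (2 * k) ^ s
  Dₐ : Fin (suc (2 * k)) → Fin m → Bool
  Dₐ a i = D i ∧ (toℕ a ℕ.≡ᵇ dist∞ x (g i))
  correctₐ : ∀ a i → Dₐ a i ≡ true → dist∞ (run (f (toℕ a)) (g i)) (g i) ≤ ρ
  correctₐ a i Dᵢ = subst (λ d → dist∞ (run (f d) (g i)) (g i) ≤ ρ)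
    (sym (ℕₚ.≡ᵇ⇒≡ (toℕ a) (dist∞ x (g i)) (subst T (sym (Boolₚ.∧-conicalʳ (D i) _ Dᵢ)) _)))
    (correct i (Boolₚ.∧-conicalˡ (D i) _ Dᵢ))

-- Passing from real to rational weights.

-- An upper cut of a sum is a sum of upper cuts, so the real weights can be replaced by
-- rational ones at the cost of an arbitrarily small increase of their total.
sumʳ-upper : ∀ {m} (f : Fin m → ℝ) {q} → Upper (sumʳ f) q →
  ∃[ u ] (∀ i → Upper (f i) (u i)) × sum u ℚ.< q
sumʳ-upper {zero}  f 0<q = (λ ()) , (λ ()) , 0<q
sumʳ-upper {suc m} f (a , b , ua , ub , a+b<q) with u , up , u<b ← sumʳ-upper (f ∘ suc) ub =
  a Vector.∷ u , (λ { zero → ua ; (suc i) → up i }) ,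
  ℚₚ.<-trans (ℚₚ.+-monoʳ-< a u<b) a+b<q

-- The hypothesis asks for a weak bound on lower cuts only, so the summand `0ʳ` of a failing outcome
-- may be matched with the rational 0.
sumʳ-lower : ∀ {m} (f : Fin m → ℝ) {v : Fin m → ℚ} → (∀ i {q} → Lower (f i) q → q ℚ.≤ v i) →
  ∀ {p} → Lower (sumʳ f) p → p ℚ.≤ sum v
sumʳ-lower {zero}  f f≤v p<0 = ℚₚ.<⇒≤ p<0
sumʳ-lower {suc m} f f≤v (a , b , la , lb , p<a+b) = ℚₚ.≤-trans (ℚₚ.<⇒≤ p<a+b)
  (ℚₚ.+-mono-≤ (f≤v zero la) (sumʳ-lower (f ∘ suc) (f≤v ∘ suc) lb))

-- The order compares lower cuts, and locatedness carries it over to upper cuts: choose `p < q`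
-- still above `y` and bracket `x` within `q - p`. The lower end of the bracket is below `p`, so its
-- upper end is below `q`.
≤ʳ⇒upper : ∀ {x y} → x ≤ʳ y → ∀ {q} → Upper y q → Upper x q
≤ʳ⇒upper {x} {y} x≤y {q} uq with p , p<q , up ← upper-open y uq
  with δ>0 ← subst (ℚ._< q ℚ.- p) (ℚₚ.+-inverseʳ p) (ℚₚ.+-monoˡ-< (ℚ.- p) p<q)
  with a , b , la , ub , b≤a+δ ← located x (q ℚ.- p) δ>0 =
  upper-closed x (ℚₚ.≤-<-trans b≤a+δ (subst (a ℚ.+ (q ℚ.- p) ℚ.<_) (cancel p q)
    (ℚₚ.+-monoˡ-< (q ℚ.- p) (disjoint y (x≤y a la) up)))) ub
  where
  open ℚ-Solver.+-*-Solver
  cancel : ∀ p q → p ℚ.+ (q ℚ.- p) ≡ q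
  cancel = solve 2 (λ p q → p :+ (q :- p) := q) refl

fromℚ-≤ʳ⇒≤ : ∀ {x r} → (∀ {p} → Lower (fromℚ r) p → p ℚ.≤ x) → r ℚ.≤ x
fromℚ-≤ʳ⇒≤ below = ℚₚ.≮⇒≥ λ x<r → let p , x<p , p<r = ℚₚ.<-dense x<r in
  ℚₚ.<-irrefl refl (ℚₚ.<-≤-trans x<p (below p<r))

fromℕ-≤ʳ⇒≤upper : ∀ {m R q} → fromℕ m ≤ʳ R → Upper R q → ι m ℚ.≤ q
fromℕ-≤ʳ⇒≤upper {m} {R} {q} m≤R uq = subst (ℚ._≤ q) (sym (ι-def m)) $ ℚₚ.≮⇒≥ λ q<m → ℚₚ.<-irrefl refl (disjoint R (m≤R _ q<m) uq)

-- Averaging over the coins.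

open RandomizedAlgorithm using (outcomes; prob; prob-nonneg; prob-total; tree)

ApproximatesWithin : ∀ {k n s} → RandomizedAlgorithm k n s → ℕ → Set
ApproximatesWithin {k} {n} A ρ = ∀ (y : Cube k n) →
  RandomizedAlgorithm.ProbAtLeast A (fromℚ (+ 2 ℚ./ 3)) (λ ω → dist∞ (run (tree A ω) y) y ≤ ρ)

-- If `m ≥ 2L`, then `L · 4/3 ≤ m · 2/3 ≤ L · S ≤ L · 6/5`, which is absurd. The number 6/5 is just
-- a value strictly between 1 and 4/3.
6/5-bound : ∀ m {L S} → 0 < L → ι m ℚ.* (+ 2 ℚ./ 3) ℚ.≤ ι L ℚ.* S → S ℚ.< + 6 ℚ./ 5 → m < 2 * L
6/5-bound m {L} {S} 0<L m≤LS S<6/5 = ℕₚ.≰⇒> λ 2L≤m →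
  from-no (ℚₚ._≤?_ ((+ 2 ℚ./ 1) ℚ.* (+ 2 ℚ./ 3)) (+ 6 ℚ./ 5)) (ℚₚ.*-cancelˡ-≤-pos (ι L) (begin
    ι L ℚ.* ((+ 2 ℚ./ 1) ℚ.* (+ 2 ℚ./ 3))    ≡⟨ cong (λ x → ι L ℚ.* (x ℚ.* (+ 2 ℚ./ 3))) (ι-def 2) ⟨
    ι L ℚ.* (ι 2 ℚ.* (+ 2 ℚ./ 3))            ≡⟨ ℚₚ.*-assoc (ι L) (ι 2) (+ 2 ℚ./ 3) ⟨
    ι L ℚ.* ι 2 ℚ.* (+ 2 ℚ./ 3)              ≡⟨ cong (ℚ._* (+ 2 ℚ./ 3)) (trans (ℚₚ.*-comm (ι L) (ι 2)) (sym (ι-* 2 L))) ⟩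
    ι (2 * L) ℚ.* (+ 2 ℚ./ 3)        ≤⟨ ℚₚ.*-monoʳ-≤-nonNeg (+ 2 ℚ./ 3) (ι-mono-≤ {2 * L} {m} 2L≤m) ⟩
    ι m ℚ.* (+ 2 ℚ./ 3)              ≤⟨ m≤LS ⟩
    ι L ℚ.* S                        ≤⟨ ℚₚ.*-monoˡ-≤-nonNeg (ι L) {{ℚ.nonNegative (0≤ι L)}} (ℚₚ.<⇒≤ S<6/5) ⟩
    ι L ℚ.* (+ 6 ℚ./ 5)              ∎))
  where
  open ℚₚ.≤-Reasoning
  instance
    L>0 : Positive (ι L)
    L>0 = ℚ.positive (0<ι 0<L)

-- Double counting of the pairs of a point and an outcome that succeeds on it: every point collects
-- weight at least 2/3, and every outcome spends at most `(2k + 1)^s` times its own weight.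
weighted-bound : ∀ {k n s m ρ} (A : RandomizedAlgorithm k n s) → ApproximatesWithin A ρ →
  (g : Fin m → Cube k n) →
  (∀ z i j → dist∞ z (g i) ≤ ρ → dist∞ z (g j) ≤ ρ → i ≡ j) →
  (u : Fin (outcomes A) → ℚ) → (∀ ω → Upper (prob A ω) (u ω)) →
  ι m ℚ.* (+ 2 ℚ./ 3) ℚ.≤ ι (suc (2 * k) ^ s) ℚ.* sum u
weighted-bound {k} {n} {s} {m} {ρ} A correct g separated u u-upper = begin
    ι m ℚ.* (+ 2 ℚ./ 3)                                         ≡⟨ sum-const m (+ 2 ℚ./ 3) ⟨
    ∑[ i < m ] (+ 2 ℚ./ 3)                                      ≤⟨ sum-mono-≤ success ⟩
    ∑[ i < m ] ∑[ ω < outcomes A ] u ω ⟦ D i ω ⟧                  ≡⟨ ∑-comm (λ i ω → u ω ⟦ D i ω ⟧) ⟩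
    ∑[ ω < outcomes A ] ∑[ i < m ] u ω ⟦ D i ω ⟧                  ≤⟨ sum-mono-≤ load ⟩
    ∑[ ω < outcomes A ] (ι (suc (2 * k) ^ s) ℚ.* u ω)             ≡⟨ *-distribˡ-sum (ι (suc (2 * k) ^ s)) u ⟨
    ι (suc (2 * k) ^ s) ℚ.* sum u                               ∎
  where
  open ℚₚ.≤-Reasoning
  0≤u : ∀ ω → 0ℚ ℚ.≤ u ω
  0≤u ω = ℚₚ.≮⇒≥ λ u<0 →
    ℚₚ.<-irrefl refl (disjoint (prob A ω) (prob-nonneg A ω (u ω) u<0) (u-upper ω))
  D : Fin m → Fin (outcomes A) → Bool
  D i = proj₁ (correct (g i))
  prob≤u : ∀ i ω {q} → Lower (if D i ω then prob A ω else 0ʳ) q → q ℚ.≤ u ω ⟦ D i ω ⟧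
  prob≤u i ω l with D i ω
  ... | true  = ℚₚ.<⇒≤ (disjoint (prob A ω) l (u-upper ω))
  ... | false = ℚₚ.<⇒≤ l
  success : ∀ i → + 2 ℚ./ 3 ℚ.≤ ∑[ ω < outcomes A ] u ω ⟦ D i ω ⟧
  success i = fromℚ-≤ʳ⇒≤ λ {p} p<2/3 →
    sumʳ-lower (λ ω → if D i ω then prob A ω else 0ʳ) (prob≤u i) (proj₂ (proj₂ (correct (g i))) p p<2/3)
  load : ∀ ω → ∑[ i < m ] u ω ⟦ D i ω ⟧ ℚ.≤ ι (suc (2 * k) ^ s) ℚ.* u ω
  load ω = weight-bound (tree A ω) g (λ i → D i ω) (0≤u ω) separated
    (λ i → proj₁ (proj₂ (correct (g i))) ω)

separated-bound : ∀ {k n s m ρ} (A : RandomizedAlgorithm k n s) → ApproximatesWithin A ρ →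
  (g : Fin m → Cube k n) →
  (∀ z i j → dist∞ z (g i) ≤ ρ → dist∞ z (g j) ≤ ρ → i ≡ j) →
  m < 2 * suc (2 * k) ^ s
separated-bound {k} {s = s} {m} A correct g separated =
  -- As the total probability is at most 1, the number 6/5 lies in its upper cut.
  let u , u-upper , u<6/5 = sumʳ-upper (prob A) (≤ʳ⇒upper {sumʳ (prob A)} {1ʳ} (proj₁ (prob-total A))
        (from-yes (ℚₚ._<?_ 1ℚ (+ 6 ℚ./ 5))))
  in  6/5-bound m (ℕₚ.m^n>0 (suc (2 * k)) s) (weighted-bound A correct g separated u u-upper) u<6/5

-- The separated grid.

-- The largest number of points of {-k, …, k} at mutual distances at least 2ρ + 1.
sites : ℕ → ℕ → ℕ
sites k ρ = suc (2 * k ℕ./ suc (2 * ρ))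

site : ∀ k ρ → Fin (sites k ρ) → Interval k
site k ρ i = ℤ.- (+ k) ℤ.+ + (suc (2 * ρ) * toℕ i)
  , ℤₚ.i≤i+j (ℤ.- (+ k)) (+ (suc (2 * ρ) * toℕ i))
  , subst (ℤ.- (+ k) ℤ.+ + (suc (2 * ρ) * toℕ i) ℤ.≤_) 2k-k≡k (ℤₚ.+-monoʳ-≤ (ℤ.- (+ k)) (ℤ.+≤+ offset≤2k))
  where
  2k-k≡k : ℤ.- (+ k) ℤ.+ + (2 * k) ≡ + k
  2k-k≡k = trans (cong (λ x → ℤ.- (+ k) ℤ.+ x) (ℤₚ.pos-* 2 k)) (simplify (+ k))
    where
    open ℤ-Solver.+-*-Solver
    simplify : ∀ x → ℤ.- x ℤ.+ + 2 ℤ.* x ≡ x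
    simplify = solve 1 (λ x → :- x :+ con (+ 2) :* x := x) refl
  offset≤2k : suc (2 * ρ) * toℕ i ≤ 2 * k
  offset≤2k = begin
    suc (2 * ρ) * toℕ i                        ≤⟨ ℕₚ.*-monoʳ-≤ (suc (2 * ρ)) (ℕₚ.≤-pred (Finₚ.toℕ<n i)) ⟩
    suc (2 * ρ) * (2 * k ℕ./ suc (2 * ρ))      ≡⟨ ℕₚ.*-comm (suc (2 * ρ)) _ ⟩
    (2 * k ℕ./ suc (2 * ρ)) * suc (2 * ρ)      ≤⟨ ℕ.m/n*n≤m (2 * k) (suc (2 * ρ)) ⟩
    2 * k                                      ∎
    where open ℕₚ.≤-Reasoning

near-both : ∀ {ρ c} z w → ∣ z ℤ.- w ∣ ≤ ρ → ∣ z ℤ.- (w ℤ.+ + c) ∣ ≤ ρ → c ≤ 2 * ρ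
near-both {ρ} {c} z w near near′ = begin
  c                                                  ≡⟨ cong ∣_∣ (difference z w (+ c)) ⟩
  ∣ (z ℤ.- w) ℤ.- (z ℤ.- (w ℤ.+ + c)) ∣              ≤⟨ ℤₚ.∣i-j∣≤∣i∣+∣j∣ (z ℤ.- w) _ ⟩
  ∣ z ℤ.- w ∣ + ∣ z ℤ.- (w ℤ.+ + c) ∣                ≤⟨ ℕₚ.+-mono-≤ near near′ ⟩
  ρ + ρ                                              ≡⟨ cong (λ x → ρ + x) (ℕₚ.+-identityʳ ρ) ⟨
  2 * ρ                                              ∎
  where
  open ℕₚ.≤-Reasoning
  difference : ∀ z w c → c ≡ (z ℤ.- w) ℤ.- (z ℤ.- (w ℤ.+ c))
  difference = solve 3 (λ z w c → c := (z :- w) :- (z :- (w :+ c))) refl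
    where open ℤ-Solver.+-*-Solver

-- Distinct sites differ by a positive multiple of `2ρ + 1`, while two points within `ρ` of `z`
-- differ by at most `2ρ`.
site-≮ : ∀ k ρ z i j → ∣ z ℤ.- proj₁ (site k ρ i) ∣ ≤ ρ → ∣ z ℤ.- proj₁ (site k ρ j) ∣ ≤ ρ →
  ¬ toℕ i < toℕ j
site-≮ k ρ z i j near-i near-j i<j with e , i+e≡j ← ℕₚ.m≤n⇒∃[o]m+o≡n i<j =
  ℕₚ.<⇒≱ (ℕₚ.≤-refl {suc (2 * ρ)}) (ℕₚ.≤-trans (ℕₚ.m≤m*n (suc (2 * ρ)) (suc e))
    (near-both z (proj₁ (site k ρ i)) near-i (subst (λ w → ∣ z ℤ.- w ∣ ≤ ρ) shift near-j)))
  where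
  d = suc (2 * ρ)
  shift : proj₁ (site k ρ j) ≡ proj₁ (site k ρ i) ℤ.+ + (d * suc e)
  shift = begin
    ℤ.- (+ k) ℤ.+ + (d * toℕ j)                       ≡⟨ cong (λ x → ℤ.- (+ k) ℤ.+ + (d * x)) (trans (sym i+e≡j) (sym (ℕₚ.+-suc (toℕ i) e))) ⟩
    ℤ.- (+ k) ℤ.+ + (d * (toℕ i + suc e))             ≡⟨ cong (λ x → ℤ.- (+ k) ℤ.+ + x) (ℕₚ.*-distribˡ-+ d (toℕ i) (suc e)) ⟩
    ℤ.- (+ k) ℤ.+ (+ (d * toℕ i) ℤ.+ + (d * suc e))   ≡⟨ ℤₚ.+-assoc (ℤ.- (+ k)) (+ (d * toℕ i)) (+ (d * suc e)) ⟨
    ℤ.- (+ k) ℤ.+ + (d * toℕ i) ℤ.+ + (d * suc e)     ∎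
    where open ≡-Reasoning

site-separated : ∀ k ρ z i j →
  ∣ z ℤ.- proj₁ (site k ρ i) ∣ ≤ ρ → ∣ z ℤ.- proj₁ (site k ρ j) ∣ ≤ ρ → i ≡ j
site-separated k ρ z i j near-i near-j = Finₚ.toℕ-injective (ℕₚ.≤-antisym
  (ℕₚ.≮⇒≥ (site-≮ k ρ z j i near-j near-i)) (ℕₚ.≮⇒≥ (site-≮ k ρ z i j near-i near-j)))

grid-separated : ∀ {k ρ n} (z : Cube k n) (v w : Vec (Fin (sites k ρ)) n) →
  dist∞ z (map (site k ρ) v) ≤ ρ → dist∞ z (map (site k ρ) w) ≤ ρ → v ≡ w
grid-separated []            []      []      _      _      = refl
grid-separated {k} {ρ} ((z , _) ∷ zs) (i ∷ v) (j ∷ w) near-v near-w = cong₂ _∷_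
  (site-separated k ρ z i j (ℕₚ.m⊔n≤o⇒m≤o _ _ near-v) (ℕₚ.m⊔n≤o⇒m≤o _ _ near-w))
  (grid-separated zs v w (ℕₚ.m⊔n≤o⇒n≤o _ _ near-v) (ℕₚ.m⊔n≤o⇒n≤o _ _ near-w))

-- Takes the place of function extensionality below.
funToFin-cong : ∀ {m n} {f g : Fin m → Fin n} → f ≗ g → funToFin f ≡ funToFin g
funToFin-cong {zero}  f≗g = refl
funToFin-cong {suc m} f≗g = cong₂ combine (f≗g zero) (funToFin-cong (f≗g ∘ suc))

-- Lets the grid points be indexed by `Fin (m ^ n)`, the form in which the averaging bound counts
-- them.
tabulate-finToFun-injective : ∀ m n {i j : Fin (m ^ n)} →
  tabulate (finToFun {m} {n} i) ≡ tabulate (finToFun j) → i ≡ j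
tabulate-finToFun-injective m n {i} {j} eq = begin
  i               ≡⟨ Finₚ.funToFin-finToFin {n} {m} i ⟨
  funToFin f      ≡⟨ funToFin-cong (λ c → trans (sym (Vecₚ.lookup∘tabulate f c))
                       (trans (cong (λ v → lookup v c) eq) (Vecₚ.lookup∘tabulate g c))) ⟩
  funToFin g      ≡⟨ Finₚ.funToFin-finToFin {n} {m} j ⟩
  j               ∎
  where
  open ≡-Reasoning
  f = finToFun {m} {n} i
  g = finToFun {m} {n} j

grid-bound : ∀ {k n s ρ} (A : RandomizedAlgorithm k n s) → ApproximatesWithin A ρ →
  sites k ρ ^ n < 2 * suc (2 * k) ^ s
grid-bound {k} {n} {ρ = ρ} A correct = separated-bound A correct
  (λ i → map (site k ρ) (tabulate (finToFun {sites k ρ} {n} i)))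
  (λ z i j near-i near-j → tabulate-finToFun-injective (sites k ρ) n
    (grid-separated z (tabulate (finToFun i)) (tabulate (finToFun j)) near-i near-j))

-- Estimates in powers of `k` and of the number of sites.

2*[2k+1]^s≤k^4s : ∀ {k} s → 2 ≤ k → 1 ≤ s → 2 * suc (2 * k) ^ s ≤ k ^ (4 * s)
2*[2k+1]^s≤k^4s {k@(suc _)} s 2≤k 1≤s = begin
  2 * suc (2 * k) ^ s      ≤⟨ ℕₚ.*-mono-≤ 2≤k (ℕₚ.^-monoˡ-≤ s 2k+1≤k^3) ⟩
  k * (k ^ 3) ^ s          ≡⟨ cong (k *_) (ℕₚ.^-*-assoc k 3 s) ⟩
  k ^ (1 + 3 * s)          ≤⟨ ℕₚ.^-monoʳ-≤ k (ℕₚ.+-monoˡ-≤ (3 * s) 1≤s) ⟩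
  k ^ (4 * s)              ∎
  where
  open ℕₚ.≤-Reasoning
  2k+1≤k^3 : suc (2 * k) ≤ k ^ 3
  2k+1≤k^3 = begin
    1 + 2 * k        ≤⟨ ℕₚ.+-monoˡ-≤ (2 * k) (ℕₚ.≤-trans (ℕₚ.n≤1+n 1) 2≤k) ⟩
    3 * k            ≤⟨ ℕₚ.*-monoˡ-≤ k (ℕₚ.n≤1+n 3) ⟩
    4 * k            ≤⟨ ℕₚ.*-monoˡ-≤ k (ℕₚ.*-mono-≤ 2≤k 2≤k) ⟩
    k * k * k        ≡⟨ solve 1 (λ k → k :* k :* k := k :* (k :* (k :* con 1))) refl k ⟩
    k ^ 3            ∎
    where open ℕ-Solver.+-*-Solver

sites^n≤k^4s : ∀ {k n s ρ} (A : RandomizedAlgorithm k n s) → ApproximatesWithin A ρ → 2 ≤ k →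
  sites k ρ ^ n ≤ k ^ (4 * s)
-- Without queries the strict bound reads `sites k ρ ^ n < 2`, which gives 1 directly. Otherwise
-- `1 ≤ s` lets one factor `k` absorb the 2.
sites^n≤k^4s {s = zero}  A correct 2≤k = ℕₚ.≤-pred (grid-bound A correct)
sites^n≤k^4s {s = suc s} A correct 2≤k =
  ℕₚ.≤-trans (ℕₚ.<⇒≤ (grid-bound A correct)) (2*[2k+1]^s≤k^4s (suc s) 2≤k (s≤s z≤n))

2≤sites : ∀ {k ρ} → ρ < k → 2 ≤ sites k ρ
2≤sites {k} {ρ} ρ<k = s≤s (ℕ.m≥n⇒m/n>0 (begin
  suc (2 * ρ)      ≤⟨ ℕₚ.n≤1+n _ ⟩
  2 + 2 * ρ        ≡⟨ ℕₚ.*-suc 2 ρ ⟨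
  2 * suc ρ        ≤⟨ ℕₚ.*-monoʳ-≤ 2 ρ<k ⟩
  2 * k            ∎))
  where open ℕₚ.≤-Reasoning

-- Division with remainder gives `2k ≤ M(2ρ + 1)`, the last site accounting for the remainder.
-- Enlarging `2ρ + 1` to `2(ρ + 1)` lets the 2 cancel.
k≤sites*[1+ρ] : ∀ k ρ → k ≤ sites k ρ * suc ρ
k≤sites*[1+ρ] k ρ = ℕₚ.*-cancelˡ-≤ 2 (begin
  2 * k                                            ≡⟨ ℕ.m≡m%n+[m/n]*n (2 * k) d ⟩
  2 * k ℕ.% d + (2 * k ℕ./ d) * d                  ≤⟨ ℕₚ.+-monoˡ-≤ ((2 * k ℕ./ d) * d) (ℕₚ.<⇒≤ (ℕ.m%n<n (2 * k) d)) ⟩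
  sites k ρ * d                                    ≤⟨ ℕₚ.*-monoʳ-≤ (sites k ρ) (ℕₚ.n≤1+n d) ⟩
  sites k ρ * (2 + 2 * ρ)                          ≡⟨ solve 2 (λ M ρ → M :* (con 2 :+ con 2 :* ρ) := con 2 :* (M :* (con 1 :+ ρ))) refl (sites k ρ) ρ ⟩
  2 * (sites k ρ * suc ρ)                          ∎)
  where
  open ℕₚ.≤-Reasoning
  open ℕ-Solver.+-*-Solver
  d = suc (2 * ρ)

1+c≤m^c : ∀ {m} c → 2 ≤ m → suc c ≤ m ^ c
1+c≤m^c     zero    2≤m = ℕₚ.≤-refl
1+c≤m^c {m} (suc c) 2≤m = begin
  suc (suc c)        ≤⟨ s≤s (ℕₚ.m≤m+n (suc c) _) ⟩
  suc (suc c + (c + 0)) ≡⟨ ℕₚ.+-suc (suc c) (c + 0) ⟨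
  2 * suc c          ≤⟨ ℕₚ.*-mono-≤ 2≤m (1+c≤m^c c 2≤m) ⟩
  m * m ^ c          ∎
  where open ℕₚ.≤-Reasoning

-- The hypothesis `1 ≤ c q` pays for the rounding: `1 + ρ ≤ (1 + c) q`, and `1 + c ≤ M^c` because
-- `M ≥ 2`.
k≤sites^[1+c]*q : ∀ {k ρ q} c → ρ < k → 0ℚ ℚ.≤ q → ι ρ ℚ.≤ q → 1ℚ ℚ.≤ ι c ℚ.* q →
  ι k ℚ.≤ ι (sites k ρ ^ suc c) ℚ.* q
k≤sites^[1+c]*q {k} {ρ} {q} c ρ<k 0≤q ρ≤q 1≤cq = begin
  ι k                                    ≤⟨ ι-mono-≤ (k≤sites*[1+ρ] k ρ) ⟩
  ι (M * suc ρ)                          ≡⟨ trans (ι-* M (suc ρ)) (cong (ι M ℚ.*_) (trans (ι-+ 1 ρ) (cong (ℚ._+ ι ρ) (ι-def 1)))) ⟩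
  ι M ℚ.* (1ℚ ℚ.+ ι ρ)                   ≤⟨ ℚₚ.*-monoˡ-≤-nonNeg (ι M) {{ℚ.nonNegative (0≤ι M)}} (ℚₚ.+-mono-≤ 1≤cq ρ≤q) ⟩
  ι M ℚ.* (ι c ℚ.* q ℚ.+ q)              ≡⟨ solve 3 (λ M c q → M :* (c :* q :+ q) := M :* (con 1ℚ :+ c) :* q) refl (ι M) (ι c) q ⟩
  ι M ℚ.* (1ℚ ℚ.+ ι c) ℚ.* q             ≡⟨ cong (λ x → ι M ℚ.* (x ℚ.+ ι c) ℚ.* q) (ι-def 1) ⟨
  ι M ℚ.* (ι 1 ℚ.+ ι c) ℚ.* q            ≡⟨ cong (ℚ._* q) (trans (ι-* M (suc c)) (cong (ι M ℚ.*_) (ι-+ 1 c))) ⟨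
  ι (M * suc c) ℚ.* q                    ≤⟨ ℚₚ.*-monoʳ-≤-nonNeg q {{ℚ.nonNegative 0≤q}} (ι-mono-≤ (ℕₚ.*-monoʳ-≤ M (1+c≤m^c c (2≤sites {k} {ρ} ρ<k)))) ⟩
  ι (M ^ suc c) ℚ.* q                    ∎
  where
  open ℚₚ.≤-Reasoning
  open ℚ-Solver.+-*-Solver
  M = sites k ρ

-- Distances are integers, so a distance at most `R`, hence below `ρ + 1`, is at most `ρ`.
approximatesWithin : ∀ {k n s ρ R q} (A : RandomizedAlgorithm k n s) → Approximates A R →
  Upper R q → q ℚ.< ι (suc ρ) → ApproximatesWithin A ρ
approximatesWithin {R = R} A correct uq q<ρ+1 y =
  let D , D⇒E , 2/3≤D = correct y
  in  D , (λ ω Dω → ℕₚ.≤-pred (ι-cancel-< (ℚₚ.≤-<-trans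
        (fromℕ-≤ʳ⇒≤upper {dist∞ (run (tree A ω) y) y} {R} (D⇒E ω Dω) uq) q<ρ+1))) , 2/3≤D

^-exchange : ∀ {M n X} e → M ^ n ≤ X → (M ^ e) ^ n ≤ X ^ e
^-exchange {M} {n} {X} e M^n≤X = begin
  (M ^ e) ^ n    ≡⟨ ℕₚ.^-*-assoc M e n ⟩
  M ^ (e * n)    ≡⟨ cong (M ^_) (ℕₚ.*-comm e n) ⟩
  M ^ (n * e)    ≡⟨ ℕₚ.^-*-assoc M n e ⟨
  (M ^ n) ^ e    ≤⟨ ℕₚ.^-monoˡ-≤ e M^n≤X ⟩
  X ^ e          ∎
  where open ℕₚ.≤-Reasoning

-- Positive fractions below a positive real.

positive-lower : ∀ {x} → 0ʳ <ʳ x → ∃[ a ] ∃[ b ] Lower x (+ suc a ℚ./ suc b)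
positive-lower {x} (q@(mkℚ (+ suc a) b _) , _   , lq) = a , b , subst (Lower x) (sym (ℚₚ.↥p/↧p≡p q)) lq
positive-lower (q@(mkℚ (+ zero)  _ _) , 0<q , _)  with () ← ℚ.positive 0<q
positive-lower (q@(mkℚ -[1+ _ ]  _ _) , 0<q , _)  with () ← ℚ.positive 0<q

ι-fraction : ∀ a b .{{_ : NonZero b}} → ι b ℚ.* (+ a ℚ./ b) ≡ ι a
ι-fraction a b@(suc b-1) = ℚₚ.toℚᵘ-injective (begin
  ℚ.toℚᵘ (ι b ℚ.* (+ a ℚ./ b))                   ≈⟨ ℚₚ.toℚᵘ-homo-* (ι b) (+ a ℚ./ b) ⟩
  ℚ.toℚᵘ (ι b) ℚᵘ.* ℚ.toℚᵘ (+ a ℚ./ b)           ≈⟨ ℚᵘₚ.*-cong (toℚᵘ-ι b) (ℚₚ.toℚᵘ-fromℚᵘ (ℚᵘ.mkℚᵘ (+ a) b-1)) ⟩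
  ℚᵘ.mkℚᵘ (+ b) 0 ℚᵘ.* ℚᵘ.mkℚᵘ (+ a) b-1         ≈⟨ ℚᵘ.*≡* (solve 2 (λ a b → b :* a :* con (+ 1) := a :* (con (+ 1) :* b)) refl (+ a) (+ b)) ⟩
  ℚᵘ.mkℚᵘ (+ a) 0                                ≈⟨ toℚᵘ-ι a ⟨
  ℚ.toℚᵘ (ι a)                                   ∎)
  where
  open ℚᵘₚ.≃-Reasoning
  open ℤ-Solver.+-*-Solver

-- The logarithmic bound.

log-bound : ∀ {k n s R q} c (A : RandomizedAlgorithm k n s) → 2 ≤ k → Approximates A R →
  Upper R q → 0ℚ ℚ.≤ q → 1ℚ ℚ.≤ ι c ℚ.* q →
  ι k ^ℚ n ℚ.≤ ι k ^ℚ (4 * suc c * s) ℚ.* q ^ℚ n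
log-bound {k} {n} {s} {R} {q} c A 2≤k correct uq 0≤q 1≤cq = bound (ℚₚ._≤?_ (ι k) q)
  where
  open ℚₚ.≤-Reasoning
  t = 4 * suc c * s
  shuffle : ∀ s c → 4 * s * c ≡ 4 * c * s
  shuffle = solve 2 (λ s c → con 4 :* s :* c := con 4 :* c :* s) refl
    where open ℕ-Solver.+-*-Solver
  bound-below : ∀ ρ → ρ < k → ι ρ ℚ.≤ q → q ℚ.< ι (suc ρ) → ι k ^ℚ n ℚ.≤ ι k ^ℚ t ℚ.* q ^ℚ n
  bound-below ρ ρ<k ρ≤q q<ρ+1 = begin
    ι k ^ℚ n                                 ≤⟨ ^ℚ-mono-≤ n (0≤ι k) (k≤sites^[1+c]*q {k} {ρ} c ρ<k 0≤q ρ≤q 1≤cq) ⟩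
    (ι (M ^ suc c) ℚ.* q) ^ℚ n               ≡⟨ ^-distrib-* (ι (M ^ suc c)) q n ⟩
    ι (M ^ suc c) ^ℚ n ℚ.* q ^ℚ n            ≡⟨ cong (ℚ._* q ^ℚ n) (ι-^ (M ^ suc c) n) ⟨
    ι ((M ^ suc c) ^ n) ℚ.* q ^ℚ n           ≤⟨ ℚₚ.*-monoʳ-≤-nonNeg (q ^ℚ n) {{ℚ.nonNegative (^ℚ-nonNeg n 0≤q)}} (ι-mono-≤ M^cn≤k^t) ⟩
    ι (k ^ t) ℚ.* q ^ℚ n                     ≡⟨ cong (ℚ._* q ^ℚ n) (ι-^ k t) ⟩
    ι k ^ℚ t ℚ.* q ^ℚ n                      ∎
    where
    M = sites k ρ
    M^cn≤k^t : (M ^ suc c) ^ n ≤ k ^ t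
    M^cn≤k^t = ℕₚ.≤-trans
      -- The grid bound `M^n ≤ k^(4s)` is raised to the power `1 + c`, whence the exponent `t`.
      (^-exchange {M} {n} (suc c) (sites^n≤k^4s A (approximatesWithin {R = R} A correct uq q<ρ+1) 2≤k))
      (ℕₚ.≤-reflexive (trans (ℕₚ.^-*-assoc k (4 * s) (suc c)) (cong (k ^_) (shuffle s (suc c)))))
  bound : Dec (ι k ℚ.≤ q) → ι k ^ℚ n ℚ.≤ ι k ^ℚ t ℚ.* q ^ℚ n
  -- For `k ≤ q` the claim follows from `k^n ≤ q^n` without any grid.
  bound (yes k≤q) = begin
    ι k ^ℚ n                                 ≤⟨ ^ℚ-mono-≤ n (0≤ι k) k≤q ⟩
    q ^ℚ n                                   ≡⟨ ℚₚ.*-identityˡ (q ^ℚ n) ⟨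
    1ℚ ℚ.* q ^ℚ n                            ≤⟨ ℚₚ.*-monoʳ-≤-nonNeg (q ^ℚ n) {{ℚ.nonNegative (^ℚ-nonNeg n 0≤q)}} (1≤ι (ℕₚ.m^n>0 k {{ℕ.>-nonZero (ℕₚ.<⇒≤ 2≤k)}} t)) ⟩
    ι (k ^ t) ℚ.* q ^ℚ n                     ≡⟨ cong (ℚ._* q ^ℚ n) (ι-^ k t) ⟩
    ι k ^ℚ t ℚ.* q ^ℚ n                      ∎
  bound (no k≰q) = let ρ , ρ<k , ρ≤q , q<ρ+1 = floor k q 0≤q (ℚₚ.≰⇒> k≰q) in bound-below ρ ρ<k ρ≤q q<ρ+1

-- The linear bound.

-- This is `(1 - 1/(m+1))^b ≥ 1 - b/(m+1)`, cleared of denominators and of subtraction.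
bernoulli : ∀ m b → suc m ^ b * suc m ≤ m ^ b * suc m + b * suc m ^ b
bernoulli m zero    = ℕₚ.m≤m+n (1 * suc m) 0
bernoulli m (suc b) = begin
  suc m * X * suc m                              ≡⟨ solve 2 (λ m x → (con 1 :+ m) :* x :* (con 1 :+ m) := m :* (x :* (con 1 :+ m)) :+ (con 1 :+ m) :* x) refl m X ⟩
  m * (X * suc m) + suc m * X                    ≤⟨ ℕₚ.+-monoˡ-≤ (suc m * X) (ℕₚ.*-monoʳ-≤ m (bernoulli m b)) ⟩
  m * (m ^ b * suc m + b * X) + suc m * X        ≤⟨ ℕₚ.m≤m+n _ (b * X) ⟩
  m * (m ^ b * suc m + b * X) + suc m * X + b * X ≡⟨ solve 4 (λ m y x b → m :* (y :* (con 1 :+ m) :+ b :* x) :+ (con 1 :+ m) :* x :+ b :* x := m :* y :* (con 1 :+ m) :+ (con 1 :+ b) :* ((con 1 :+ m) :* x)) refl m (m ^ b) X b ⟩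
  m * m ^ b * suc m + suc b * (suc m * X)        ∎
  where
  open ℕₚ.≤-Reasoning
  open ℕ-Solver.+-*-Solver
  X = suc m ^ b

-- For `m = 2b` the right side of Bernoulli's inequality is `1 - b/(2b+1) > 1/2`.
[1+2b]^b<2*[2b]^b : ∀ b → suc (2 * b) ^ b < 2 * (2 * b) ^ b
[1+2b]^b<2*[2b]^b b = ℕₚ.*-cancelʳ-< (suc m) X (2 * m ^ b) (ℕₚ.+-cancelʳ-< (2 * (b * X)) _ _ (begin-strict
  X * suc m + 2 * (b * X)                  <⟨ ℕₚ.m<m+n _ (ℕₚ.m^n>0 (suc m) b) ⟩
  X * suc m + 2 * (b * X) + X              ≡⟨ solve 2 (λ b x → x :* (con 1 :+ con 2 :* b) :+ con 2 :* (b :* x) :+ x := con 2 :* (x :* (con 1 :+ con 2 :* b))) refl b X ⟩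
  2 * (X * suc m)                          ≤⟨ ℕₚ.*-monoʳ-≤ 2 (bernoulli m b) ⟩
  2 * (m ^ b * suc m + b * X)              ≡⟨ solve 3 (λ y m z → con 2 :* (y :* (con 1 :+ m) :+ z) := con 2 :* y :* (con 1 :+ m) :+ con 2 :* z) refl (m ^ b) m (b * X) ⟩
  2 * m ^ b * suc m + 2 * (b * X)          ∎))
  where
  open ℕₚ.≤-Reasoning
  open ℕ-Solver.+-*-Solver
  m = 2 * b
  X = suc m ^ b

-- Trades the upper approximation `q` for a lower one `x`: as `q ≤ x + 1 ≤ 2x`, the earlier estimate
-- at `2x` with `c = 1` gives `k ≤ M² · 2x`, and `M ≥ 2` absorbs the 2.
k≤sites^3*x : ∀ {k ρ x q} → ρ < k → ι ρ ℚ.≤ q → q ℚ.≤ x ℚ.+ 1ℚ → 1ℚ ℚ.≤ x →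
  ι k ℚ.≤ ι (sites k ρ ^ 3) ℚ.* x
k≤sites^3*x {k} {ρ} {x} {q} ρ<k ρ≤q q≤x+1 1≤x = begin
  ι k                                  ≤⟨ k≤sites^[1+c]*q {k} {ρ} 1 ρ<k 0≤2x ρ≤2x 1≤2x ⟩
  ι (M ^ 2) ℚ.* (ι 2 ℚ.* x)            ≤⟨ ℚₚ.*-monoˡ-≤-nonNeg (ι (M ^ 2)) {{ℚ.nonNegative (0≤ι (M ^ 2))}} (ℚₚ.*-monoʳ-≤-nonNeg x {{ℚ.nonNegative 0≤x}} (ι-mono-≤ (2≤sites {k} {ρ} ρ<k))) ⟩
  ι (M ^ 2) ℚ.* (ι M ℚ.* x)            ≡⟨ solve 3 (λ y m x → y :* (m :* x) := m :* y :* x) refl (ι (M ^ 2)) (ι M) x ⟩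
  ι M ℚ.* ι (M ^ 2) ℚ.* x              ≡⟨ cong (ℚ._* x) (ι-* M (M ^ 2)) ⟨
  ι (M ^ 3) ℚ.* x                      ∎
  where
  open ℚₚ.≤-Reasoning
  open ℚ-Solver.+-*-Solver
  M = sites k ρ
  0≤x : 0ℚ ℚ.≤ x
  0≤x = ℚₚ.≤-trans (ℚₚ.nonNegative⁻¹ 1ℚ) 1≤x
  2x≡x+x : ι 2 ℚ.* x ≡ x ℚ.+ x
  2x≡x+x = trans (cong (ℚ._* x) (trans (ι-+ 1 1) (cong₂ ℚ._+_ (ι-def 1) (ι-def 1))))
    (solve 1 (λ x → (con 1ℚ :+ con 1ℚ) :* x := x :+ x) refl x)
  0≤2x : 0ℚ ℚ.≤ ι 2 ℚ.* x
  0≤2x = *-nonNeg (0≤ι 2) 0≤x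
  ρ≤2x : ι ρ ℚ.≤ ι 2 ℚ.* x
  ρ≤2x = ℚₚ.≤-trans ρ≤q (ℚₚ.≤-trans q≤x+1
    (subst (x ℚ.+ 1ℚ ℚ.≤_) (sym 2x≡x+x) (ℚₚ.+-monoʳ-≤ x 1≤x)))
  1≤2x : 1ℚ ℚ.≤ ι 1 ℚ.* (ι 2 ℚ.* x)
  1≤2x = subst₂ ℚ._≤_ (ℚₚ.*-identityˡ 1ℚ) refl
    (*-mono-≤-nonNeg (ℚₚ.nonNegative⁻¹ 1ℚ) 0≤2x (1≤ι ℕₚ.≤-refl)
      (ℚₚ.≤-trans 1≤x (subst (x ℚ.≤_) (sym 2x≡x+x)
        (subst (ℚ._≤ x ℚ.+ x) (ℚₚ.+-identityʳ x) (ℚₚ.+-monoʳ-≤ x 0≤x)))))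

ι^-positive : ∀ {k} n → 1 ≤ k → Positive (ι k ^ℚ n)
ι^-positive {k} n 1≤k =
  ℚ.positive (subst (0ℚ ℚ.<_) (ι-^ k n) (0<ι (ℕₚ.m^n>0 k {{ℕ.>-nonZero 1≤k}} n)))

ι≤ι^[1+n] : ∀ {k} n → 1 ≤ k → ι k ℚ.≤ ι k ^ℚ suc n
ι≤ι^[1+n] {k} n 1≤k = subst (ι k ℚ.≤_) (ι-^ k (suc n))
  (ι-mono-≤ (ℕₚ.m≤m*n k (k ^ n) {{ℕ.>-nonZero (ℕₚ.m^n>0 k {{ℕ.>-nonZero 1≤k}} n)}}))

unit : ℕ → ℚ
unit m = + 1 ℚ./ suc m

[1+m]*unit≡1 : ∀ m → ι (suc m) ℚ.* unit m ≡ 1ℚ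
[1+m]*unit≡1 m = trans (ι-fraction 1 (suc m)) (ι-def 1)

0<unit : ∀ m → 0ℚ ℚ.< unit m
0<unit m = ℚₚ.positive⁻¹ (unit m) {{ℚₚ.normalize-pos 1 (suc m)}}

unit≤1 : ∀ m → unit m ℚ.≤ 1ℚ
unit≤1 m = subst₂ ℚ._≤_ (ℚₚ.*-identityˡ (unit m)) ([1+m]*unit≡1 m)
  (ℚₚ.*-monoʳ-≤-nonNeg (unit m) {{ℚ.nonNegative (ℚₚ.<⇒≤ (0<unit m))}} (1≤ι (s≤s z≤n)))

-- By Bernoulli's inequality this rational number below k is too large to satisfy p ≤ k¹⁻ᵃᐟᵇ
-- for any a ≥ 1, so R and a sufficiently close q > R lie below k.
below-k : ℕ → ℕ → ℚ
below-k k b = ι k ℚ.* (ι (2 * b) ℚ.* unit (2 * b))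

0≤below-k : ∀ k b → 0ℚ ℚ.≤ below-k k b
0≤below-k k b = *-nonNeg (0≤ι k) (*-nonNeg (0≤ι (2 * b)) (ℚₚ.<⇒≤ (0<unit (2 * b))))

-- The gap from `below-k k b` to `k` is `k/(2b+1)`, wider than `1/(2b+1)` because `k > 1`. So `R`
-- may be located with precision `unit (2 * b)`.
below-k+unit<k : ∀ {k} b → 2 ≤ k → below-k k b ℚ.+ unit (2 * b) ℚ.< ι k
below-k+unit<k {k} b 2≤k = begin-strict
  ι k ℚ.* (ι m ℚ.* δ) ℚ.+ δ                  ≡⟨ cong (ι k ℚ.* (ι m ℚ.* δ) ℚ.+_) (ℚₚ.*-identityˡ δ) ⟨
  ι k ℚ.* (ι m ℚ.* δ) ℚ.+ 1ℚ ℚ.* δ           <⟨ ℚₚ.+-monoʳ-< (ι k ℚ.* (ι m ℚ.* δ)) (ℚₚ.*-monoˡ-<-pos δ {{ℚ.positive (0<unit m)}} 1<k) ⟩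
  ι k ℚ.* (ι m ℚ.* δ) ℚ.+ ι k ℚ.* δ          ≡⟨ solve 3 (λ k m d → k :* (m :* d) :+ k :* d := k :* ((con 1ℚ :+ m) :* d)) refl (ι k) (ι m) δ ⟩
  ι k ℚ.* ((1ℚ ℚ.+ ι m) ℚ.* δ)               ≡⟨ cong (λ y → ι k ℚ.* (y ℚ.* δ)) (trans (ι-+ 1 m) (cong (ℚ._+ ι m) (ι-def 1))) ⟨
  ι k ℚ.* (ι (suc m) ℚ.* δ)                  ≡⟨ cong (ι k ℚ.*_) ([1+m]*unit≡1 m) ⟩
  ι k ℚ.* 1ℚ                                 ≡⟨ ℚₚ.*-identityʳ (ι k) ⟩
  ι k                                        ∎
  where
  open ℚₚ.≤-Reasoning
  open ℚ-Solver.+-*-Solver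
  m = 2 * b
  δ = unit m
  1<k : 1ℚ ℚ.< ι k
  1<k = subst (ℚ._< ι k) (ι-def 1) (ι-mono-< 2≤k)

-- With `y = 2b/(2b+1)`, cancelling `k^b` leaves `y^b k^(a+1) ≤ 1`. Since `2 ≤ k^(a+1)`, this gives
-- `2 y^b ≤ 1`, against the preceding strict inequality.
below-k-large : ∀ {k} a b → 2 ≤ k → ¬ below-k k b ^ℚ b ℚ.* ι k ^ℚ suc a ℚ.≤ ι k ^ℚ b
below-k-large {k} a b 2≤k bounded = ℕₚ.<⇒≱ ([1+2b]^b<2*[2b]^b b) (ι-cancel-≤ (begin
  ι (2 * m ^ b)                                          ≡⟨ trans (ι-* 2 (m ^ b)) (ℚₚ.*-comm (ι 2) (ι (m ^ b))) ⟩
  ι (m ^ b) ℚ.* ι 2                                      ≡⟨ cong (ℚ._* ι 2) (trans (ι-^ m b) (cong (_^ℚ b) (sym y*[1+m]≡m))) ⟩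
  (y ℚ.* ι (suc m)) ^ℚ b ℚ.* ι 2                         ≡⟨ cong (ℚ._* ι 2) (^-distrib-* y (ι (suc m)) b) ⟩
  y ^ℚ b ℚ.* ι (suc m) ^ℚ b ℚ.* ι 2                      ≡⟨ solve 3 (λ u v w → u :* v :* w := u :* w :* v) refl (y ^ℚ b) (ι (suc m) ^ℚ b) (ι 2) ⟩
  y ^ℚ b ℚ.* ι 2 ℚ.* ι (suc m) ^ℚ b                      ≤⟨ ℚₚ.*-monoʳ-≤-nonNeg (ι (suc m) ^ℚ b) {{ℚ.nonNegative (^ℚ-nonNeg b (0≤ι (suc m)))}} 2y^b≤1 ⟩
  1ℚ ℚ.* ι (suc m) ^ℚ b                                  ≡⟨ trans (ℚₚ.*-identityˡ (ι (suc m) ^ℚ b)) (sym (ι-^ (suc m) b)) ⟩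
  ι (suc m ^ b)                                          ∎))
  where
  open ℚₚ.≤-Reasoning
  open ℚ-Solver.+-*-Solver
  m = 2 * b
  y = ι m ℚ.* unit m
  y*[1+m]≡m : y ℚ.* ι (suc m) ≡ ι m
  y*[1+m]≡m = begin-equality
    ι m ℚ.* unit m ℚ.* ι (suc m)        ≡⟨ solve 3 (λ u v w → u :* v :* w := u :* (w :* v)) refl (ι m) (unit m) (ι (suc m)) ⟩
    ι m ℚ.* (ι (suc m) ℚ.* unit m)      ≡⟨ cong (ι m ℚ.*_) ([1+m]*unit≡1 m) ⟩
    ι m ℚ.* 1ℚ                          ≡⟨ ℚₚ.*-identityʳ (ι m) ⟩
    ι m                                 ∎
  0≤y : 0ℚ ℚ.≤ y
  0≤y = *-nonNeg (0≤ι m) (ℚₚ.<⇒≤ (0<unit m))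
  2y^b≤1 : y ^ℚ b ℚ.* ι 2 ℚ.≤ 1ℚ
  2y^b≤1 = ℚₚ.*-cancelˡ-≤-pos (ι k ^ℚ b) {{ι^-positive b (ℕₚ.<⇒≤ 2≤k)}} (begin
    ι k ^ℚ b ℚ.* (y ^ℚ b ℚ.* ι 2)                 ≡⟨ ℚₚ.*-assoc (ι k ^ℚ b) (y ^ℚ b) (ι 2) ⟨
    ι k ^ℚ b ℚ.* y ^ℚ b ℚ.* ι 2                   ≡⟨ cong (ℚ._* ι 2) (^-distrib-* (ι k) y b) ⟨
    (ι k ℚ.* y) ^ℚ b ℚ.* ι 2                      ≤⟨ ℚₚ.*-monoˡ-≤-nonNeg ((ι k ℚ.* y) ^ℚ b) {{ℚ.nonNegative (^ℚ-nonNeg b (0≤below-k k b))}} (ℚₚ.≤-trans (ι-mono-≤ 2≤k) (ι≤ι^[1+n] a (ℕₚ.<⇒≤ 2≤k))) ⟩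
    (ι k ℚ.* y) ^ℚ b ℚ.* ι k ^ℚ suc a             ≤⟨ bounded ⟩
    ι k ^ℚ b                                      ≡⟨ ℚₚ.*-identityʳ (ι k ^ℚ b) ⟨
    ι k ^ℚ b ℚ.* 1ℚ                               ∎)

k≤sites^3^b : ∀ {k ρ p q} a b → 2 ≤ k → ρ < k → ι ρ ℚ.≤ q → q ℚ.≤ p ℚ.+ 1ℚ →
  (0ℚ ℚ.≤ p → p ^ℚ suc b ℚ.* ι k ^ℚ suc a ℚ.≤ ι k ^ℚ suc b) →
  k ≤ (sites k ρ ^ 3) ^ suc b
k≤sites^3^b {k} {ρ} {p} {q} a b-1 2≤k ρ<k ρ≤q q≤p+1 bounded with ℚₚ._≤?_ 1ℚ p
-- Here `q ≤ p + 1 ≤ 2`, so the estimate applies with `x = 1`.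
... | no p≱1 = ℕₚ.≤-trans
  (ι-cancel-≤ (subst (ι k ℚ.≤_) (ℚₚ.*-identityʳ (ι (M ^ 3)))
    (k≤sites^3*x {k} {ρ} ρ<k ρ≤q (ℚₚ.≤-trans q≤p+1 (ℚₚ.+-monoˡ-≤ 1ℚ (ℚₚ.<⇒≤ (ℚₚ.≰⇒> p≱1)))) ℚₚ.≤-refl)))
  (ℕₚ.m≤m*n (M ^ 3) ((M ^ 3) ^ b-1) {{ℕₚ.m^n≢0 (M ^ 3) b-1 {{ℕₚ.m^n≢0 M 3}}}})
  where M = sites k ρ
... | yes 1≤p = ι-cancel-≤ (begin
  ι k                        ≤⟨ ι≤ι^[1+n] a (ℕₚ.<⇒≤ 2≤k) ⟩
  ι k ^ℚ suc a               ≤⟨ ℚₚ.*-cancelˡ-≤-pos (ι k ^ℚ b) {{ι^-positive b (ℕₚ.<⇒≤ 2≤k)}} scaled ⟩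
  ι (M ^ 3) ^ℚ b             ≡⟨ ι-^ (M ^ 3) b ⟨
  ι ((M ^ 3) ^ b)            ∎)
  where
  open ℚₚ.≤-Reasoning
  M = sites k ρ
  b = suc b-1
  scaled : ι k ^ℚ b ℚ.* ι k ^ℚ suc a ℚ.≤ ι k ^ℚ b ℚ.* ι (M ^ 3) ^ℚ b
  -- The power `k^b ≤ (M³ p)^b` is multiplied by `k^(a+1)`, so that the hypothesis turns
  -- `p^b k^(a+1)` into `k^b`.
  scaled = begin
    ι k ^ℚ b ℚ.* ι k ^ℚ suc a                        ≤⟨ ℚₚ.*-monoʳ-≤-nonNeg (ι k ^ℚ suc a) {{ℚ.nonNegative (^ℚ-nonNeg (suc a) (0≤ι k))}} (^ℚ-mono-≤ b (0≤ι k) (k≤sites^3*x {k} {ρ} ρ<k ρ≤q q≤p+1 1≤p)) ⟩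
    (ι (M ^ 3) ℚ.* p) ^ℚ b ℚ.* ι k ^ℚ suc a          ≡⟨ cong (ℚ._* ι k ^ℚ suc a) (^-distrib-* (ι (M ^ 3)) p b) ⟩
    ι (M ^ 3) ^ℚ b ℚ.* p ^ℚ b ℚ.* ι k ^ℚ suc a       ≡⟨ ℚₚ.*-assoc (ι (M ^ 3) ^ℚ b) (p ^ℚ b) (ι k ^ℚ suc a) ⟩
    ι (M ^ 3) ^ℚ b ℚ.* (p ^ℚ b ℚ.* ι k ^ℚ suc a)     ≤⟨ ℚₚ.*-monoˡ-≤-nonNeg (ι (M ^ 3) ^ℚ b) {{ℚ.nonNegative (^ℚ-nonNeg b (0≤ι (M ^ 3)))}} (bounded (ℚₚ.≤-trans (ℚₚ.nonNegative⁻¹ 1ℚ) 1≤p)) ⟩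
    ι (M ^ 3) ^ℚ b ℚ.* ι k ^ℚ b                      ≡⟨ ℚₚ.*-comm (ι (M ^ 3) ^ℚ b) (ι k ^ℚ b) ⟩
    ι k ^ℚ b ℚ.* ι (M ^ 3) ^ℚ b                      ∎

linear-bound : ∀ {k n s R} a b (A : RandomizedAlgorithm k n s) → 2 ≤ k → 0ʳ <ʳ R → Approximates A R →
  (∀ p → 0ℚ ℚ.≤ p → Lower R p → p ^ℚ suc b ℚ.* ι k ^ℚ suc a ℚ.≤ ι k ^ℚ suc b) →
  n ≤ 12 * suc b * s
linear-bound {k} {n} {s} {R} a b-1 A 2≤k (r , 0<r , lr) correct bounded =
  let p , q , lp , uq , q≤p+δ = located R δ (0<unit (2 * b))
      -- If `p` exceeded `below-k k b`, the latter would lie below `R` and violate the hypothesis on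
      -- `R`.
      p≤k⁻ = ℚₚ.≮⇒≥ λ k⁻<p → below-k-large a b 2≤k
               (bounded (below-k k b) (0≤below-k k b) (lower-closed R k⁻<p lp))
      q<k = ℚₚ.≤-<-trans (ℚₚ.≤-trans q≤p+δ (ℚₚ.+-monoˡ-≤ δ p≤k⁻)) (below-k+unit<k b 2≤k)
      q≤p+1 = ℚₚ.≤-trans q≤p+δ (ℚₚ.+-monoʳ-≤ p (unit≤1 (2 * b)))
      0≤q = ℚₚ.<⇒≤ (ℚₚ.<-trans 0<r (disjoint R lr uq))
      ρ , ρ<k , ρ≤q , q<ρ+1 = floor k q 0≤q q<k
  in  conclude ρ (k≤sites^3^b a b-1 2≤k ρ<k ρ≤q q≤p+1 (λ 0≤p → bounded p 0≤p lp))
        (sites^n≤k^4s A (approximatesWithin {R = R} A correct uq q<ρ+1) 2≤k)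
  where
  open ℕₚ.≤-Reasoning
  b = suc b-1
  δ = unit (2 * b)
  shuffle : ∀ s b → 4 * s * (3 * b) ≡ 12 * b * s
  shuffle = solve 2 (λ s b → con 4 :* s :* (con 3 :* b) := con 12 :* b :* s) refl
    where open ℕ-Solver.+-*-Solver
  conclude : ∀ ρ → k ≤ (sites k ρ ^ 3) ^ b → sites k ρ ^ n ≤ k ^ (4 * s) → n ≤ 12 * b * s
  -- Comparing `k^n ≤ M^(3bn) ≤ k^(12bs)` gives the claim, as powers of `k ≥ 2` increase strictly.
  conclude ρ k≤M^3b M^n≤k^4s = ℕₚ.≮⇒≥ λ t<n → ℕₚ.<⇒≱ (ℕₚ.^-monoʳ-< k 2≤k t<n) (begin
    k ^ n                          ≤⟨ ℕₚ.^-monoˡ-≤ n k≤M^3b ⟩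
    ((sites k ρ ^ 3) ^ b) ^ n      ≡⟨ cong (_^ n) (ℕₚ.^-*-assoc (sites k ρ) 3 b) ⟩
    (sites k ρ ^ (3 * b)) ^ n      ≤⟨ ^-exchange {sites k ρ} {n} (3 * b) M^n≤k^4s ⟩
    (k ^ (4 * s)) ^ (3 * b)        ≡⟨ ℕₚ.^-*-assoc k (4 * s) (3 * b) ⟩
    k ^ (4 * s * (3 * b))          ≡⟨ cong (k ^_) (shuffle s b) ⟩
    k ^ (12 * b * s)               ∎)

-- Choice of the constants.

theorem8 : ( (r : ℝ) → 0ʳ <ʳ r →
    ∃[ C ] (∀ (n k : ℕ) → 1 ≤ n → 2 ≤ k →
    (R : ℝ) → r ≤ʳ R → R ≤ʳ fromℕ k →
    (s : ℕ) (A : RandomizedAlgorithm k n s) → Approximates A R →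
    n ·log[ k ÷ R ]≤ C * s ·log k) )
    ×
    ( (ε : ℝ) → 0ʳ <ʳ ε →
    ∃[ C ] (∀ (n k : ℕ) → 1 ≤ n → 2 ≤ k →
    (R : ℝ) → 0ʳ <ʳ R → R ≤ʳ fromℕ k → R ≤ʳ k ^1- ε →
    (s : ℕ) (A : RandomizedAlgorithm k n s) → Approximates A R →
    n ≤ C * s) )
theorem8 = logarithmic , linear
  where
  logarithmic : (r : ℝ) → 0ʳ <ʳ r →
    ∃[ C ] (∀ (n k : ℕ) → 1 ≤ n → 2 ≤ k →
    (R : ℝ) → r ≤ʳ R → R ≤ʳ fromℕ k →
    (s : ℕ) (A : RandomizedAlgorithm k n s) → Approximates A R →
    n ·log[ k ÷ R ]≤ C * s ·log k)
  logarithmic r 0<r =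
    -- The denominator `c` of a positive fraction `r₀` below `r` satisfies `1 ≤ c r₀`, hence
    -- `1 ≤ c q` for every rational `q > R`. The constant thus depends on `r` alone.
    let a , c-1 , la = positive-lower {r} 0<r
        c = suc c-1
        r₀ = + suc a ℚ./ c
        0≤r₀ = ℚₚ.nonNegative⁻¹ r₀ {{ℚₚ.normalize-nonNeg (suc a) c}}
        1≤cr₀ = subst (1ℚ ℚ.≤_) (sym (ι-fraction (suc a) c)) (1≤ι (s≤s z≤n))
    in  4 * suc c , λ n k _ 2≤k R r≤R _ s A correct q uq →
        let r₀<q = disjoint R (r≤R r₀ la) uq
            r₀≤q = ℚₚ.<⇒≤ r₀<q
        in  subst (λ κ → κ ^ℚ n ℚ.≤ κ ^ℚ (4 * suc c * s) ℚ.* q ^ℚ n) (ι-def k)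
              (log-bound {R = R} c A 2≤k correct uq (ℚₚ.≤-trans 0≤r₀ r₀≤q)
                (ℚₚ.≤-trans 1≤cr₀ (ℚₚ.*-monoˡ-≤-nonNeg (ι c) {{ℚ.nonNegative (0≤ι c)}} r₀≤q)))
  linear : (ε : ℝ) → 0ʳ <ʳ ε →
    ∃[ C ] (∀ (n k : ℕ) → 1 ≤ n → 2 ≤ k →
    (R : ℝ) → 0ʳ <ʳ R → R ≤ʳ fromℕ k → R ≤ʳ k ^1- ε →
    (s : ℕ) (A : RandomizedAlgorithm k n s) → Approximates A R →
    n ≤ C * s)
  linear ε 0<ε =
    -- The fraction `suc a / suc b` below `ε` has numerator at least 1, and its denominator
    -- determines the constant.
    let a , b , lb = positive-lower {ε} 0<ε
    in  12 * suc b , λ n k _ 2≤k R 0<R _ R≤k^1-ε s A correct →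
        linear-bound {R = R} a b A 2≤k 0<R correct λ p 0≤p lp →
          subst (λ κ → p ^ℚ suc b ℚ.* κ ^ℚ suc a ℚ.≤ κ ^ℚ suc b) (sym (ι-def k))
            (R≤k^1-ε (suc a) (suc b) lb p 0≤p lp)
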